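{- Let $n\ge4$ and let $S$ be an inductive strategy of length $n$ with $S[n]\neq[n,1,2,\dots,n-1]$ (i.e. $S\neq CSL$). Let $N_S$ (resp. $N_{CSL}$) be the number of permutations $\pi\in S_n$ such that the game with strategy $S$ (resp. $CSL$) and secret $\pi$ ends after exactly three guesses and $\rho_S(\pi)=2$ (resp. $\rho_{CSL}(\pi)=2$). Then $N_S>N_{CSL}$.
   Context: Permutation wordle on $[n]=\{1,\dots,n\}$: a secret permutation $\pi\in S_n$ (one-line notation) is fixed. The first guess is $\gamma_1=[1,2,\dots,n]$. After guess $\gamma_r$ the guesser learns $\mathcal{J}_r=\{i:\gamma_r(i)=\pi(i)\}$; $\mathcal{I}_r=[n]\setminus\mathcal{J}_r$. The game ends at the first $r$ with $\mathcal{J}_r=[n]$. A strategy of length $n$ is a sequence $S=(S[1],\dots,S[n])$ with $S[k]$ a permutation of $[k]$; if $\mathcal{I}_r=\{i_1<\dots<i_k\}\neq\emptyset$ and $\sigma=S[k]$, then $\gamma_{r+1}(i)=\gamma_r(i)$ for $i\in\mathcal{J}_r$ and $\gamma_{r+1}(i_{\sigma(j)})=\gamma_r(i_j)$ for $j=1,\dots,k$. The cyclic shift strategy $CS$ has $CS[k]=[2,3,\dots,k,1]$. An inductive strategy of length $n$ has $S[k]=CS[k]$ for $1\le k\le n-1$ and $S[n]$ an arbitrary cyclic permutation (single $n$-cycle) of $[n]$. $CSL$ is the inductive strategy with $CSL[n]=[n,1,2,\dots,n-1]$. For a secret $\pi$, $\rho_S(\pi)=\min\{i:\mathcal{J}_i\neq\emptyset\}$.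 -}

module Defs where

open import Data.Nat using (ℕ; zero; suc; _+_; _<?_; _≟_)
open import Data.Bool using (Bool; true; false; _∧_; not)
open import Data.Fin using (Fin; zero; suc; toℕ; fromℕ; fromℕ<; inject₁)
import Data.Fin as F
open import Data.Fin.Permutation using (Permutation′; _⟨$⟩ʳ_)
open import Data.List using (List; []; _∷_; length; map; concatMap; filterᵇ; allFin)
open import Data.Bool.ListAction using (all; any)
open import Data.Vec using (Vec; lookup; _[_]≔_; fromList; toList)
import Data.Vec as V
open import Data.Product using (∃)
open import Function using (_∘_; id)
open import Relation.Nullary using (does; yes; no)
open import Relation.Binary.PropositionalEquality using (_≡_; refl)

-- Conventions: [k] = {1,…,k} is represented by Fin k = {0,…,k-1}
-- (value i ∈ Fin k stands for i+1). A permutation in one-line notation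
-- is a vector / map Fin n → Fin n.

_==_ : ∀ {n} → Fin n → Fin n → Bool
i == j = does (i F.≟ j)

rotR : ∀ {k} → Fin k → Fin k
rotR {suc m} j with suc (toℕ j) <? suc m
... | yes p = fromℕ< p
... | no _  = zero

rotL : ∀ {k} → Fin k → Fin k
rotL {suc m} zero    = fromℕ m
rotL {suc m} (suc j) = inject₁ j

-- A strategy: for every k, S[k] as a map of [k]
-- (only the values for 1 ≤ k ≤ n are ever used in a game of length n).
Strategy : Set
Strategy = (k : ℕ) → Fin k → Fin k

inductiveS : (n : ℕ) → (Fin n → Fin n) → Strategy
inductiveS n c k with k ≟ n
... | yes refl = c
... | no _     = rotR

CSL : (n : ℕ) → Strategy
CSL n = inductiveS n rotL

IsCyclic : ∀ {n} → Permutation′ n → Set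
IsCyclic {n} σ = ∀ (i j : Fin n) → ∃ λ m → iter m i ≡ j
  where
  iter : ℕ → Fin n → Fin n
  iter zero    i = i
  iter (suc m) i = σ ⟨$⟩ʳ (iter m i)

-- One round of the game: from guess γ and secret π produce the next guess.
-- I = increasing list of mismatched positions i_1 < … < i_k, σ = S[k],
-- new guess: γ'(i) = γ(i) on matches, γ'(i_{σ(j)}) = γ(i_j).
step : ∀ {n} → Strategy → Vec (Fin n) n → Vec (Fin n) n → Vec (Fin n) n
step {n} S π γ = Data.List.foldr upd γ (allFin k)
  where
  I : List (Fin n)
  I = filterᵇ (λ i → not (lookup γ i == lookup π i)) (allFin n)
  k : ℕ
  k = length I
  Iv : Vec (Fin n) k
  Iv = fromList I
  upd : Fin k → Vec (Fin n) n → Vec (Fin n) n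
  upd j v = v [ lookup Iv (S k j) ]≔ lookup γ (lookup Iv j)

-- guess S π r = γ_{r+1}; γ_1 = [1,2,…,n]
guess : ∀ {n} → Strategy → Vec (Fin n) n → ℕ → Vec (Fin n) n
guess {n} S π zero    = V.allFin n
guess {n} S π (suc r) = step S π (guess S π r)

allMatch : ∀ {n} → Vec (Fin n) n → Vec (Fin n) n → Bool
allMatch {n} π γ = all (λ i → lookup γ i == lookup π i) (allFin n)

noMatch : ∀ {n} → Vec (Fin n) n → Vec (Fin n) n → Bool
noMatch {n} π γ = all (λ i → not (lookup γ i == lookup π i)) (allFin n)

-- game ends after exactly three guesses and ρ_S(π) = 2
-- (J_1 = ∅, J_2 ≠ ∅, J_1 ≠ [n], J_2 ≠ [n], J_3 = [n])
good : ∀ {n} → Strategy → Vec (Fin n) n → Bool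
good S π =
  noMatch π (guess S π 0) ∧ not (allMatch π (guess S π 0)) ∧
  not (noMatch π (guess S π 1)) ∧ not (allMatch π (guess S π 1)) ∧
  allMatch π (guess S π 2)

allVecs : (n m : ℕ) → List (Vec (Fin n) m)
allVecs n zero    = Vec.[] ∷ []
allVecs n (suc m) = concatMap (λ x → map (x Vec.∷_) (allVecs n m)) (allFin n)

isPerm : ∀ {n} → Vec (Fin n) n → Bool
isPerm {n} v =
  all (λ i → all (λ j → not (lookup v i == lookup v j) Data.Bool.∨ (i == j)) (allFin n)) (allFin n)
  ∧ all (λ y → any (λ i → lookup v i == y) (allFin n)) (allFin n)

Sn : (n : ℕ) → List (Vec (Fin n) n)
Sn n = filterᵇ isPerm (allVecs n n)

N : (n : ℕ) → Strategy → ℕ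
N n S = length (filterᵇ (good S) (Sn n))

{-# OPTIONS --safe #-}

-- Let c = S[n].  In a game won in three guesses with ρ = 2, the second guess is c⁻¹, and the
-- secret π is determined by the set I of positions where c⁻¹ and π differ: π agrees with c⁻¹ off I
-- and is c⁻¹ shifted cyclically along I.  The sets I that arise are those with 2 ≤ |I| < n such that
-- no i ∈ I has c(i) as its cyclic predecessor in I; otherwise π(i) = i.  For CSL, where c(i) = i − 1,
-- these are the sets of at least two elements containing no pair i, c(i).  All n-cycles being
-- conjugate, there are equally many such sets for any other n-cycle c, and they are all admissible
-- for c.  If c(i) ≠ i − 1, then {i, i − 1, c(i)} is a further admissible set, since i − 1 separates
-- c(i) from i.

module Submission where

open import Defs
open import Data.Nat using (ℕ; zero; suc; _+_; _*_; _∸_; _≤_; _<_; _≟_; _<?_; z≤n; s≤s; s≤s⁻¹)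
import Data.Nat.Properties as ℕ
open import Data.Nat.DivMod using (_%_; _/_; m≡m%n+[m/n]*n; m%n<n)
open import Data.Bool using (Bool; true; false; _∧_; _∨_; not; T)
open import Data.Bool.Properties using (T-≡; T-∧; T-∨; T?)
open import Data.Bool.ListAction using (all)
open import Data.Empty using (⊥-elim)
open import Data.Fin using (Fin; zero; suc; toℕ; fromℕ<; cast)
import Data.Fin as F
import Data.Fin.Properties as F
open import Data.Fin.Permutation using (Permutation′; _⟨$⟩ʳ_; _⟨$⟩ˡ_; inverseˡ)
open import Data.List using (List; []; _∷_; length; map; concatMap; filterᵇ; allFin; foldr; lookup)
open import Data.List.Properties using (length-tabulate; lookup-tabulate; filter-≐; filter-notAll)
open import Data.List.Relation.Unary.All using ([]; _∷_)
import Data.List.Relation.Unary.All as All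
import Data.List.Relation.Unary.All.Properties as All
open import Data.List.Relation.Unary.Any using (here; there; index)
import Data.List.Relation.Unary.Any as Any
import Data.List.Relation.Unary.Any.Properties as Any
open import Data.List.Relation.Unary.AllPairs using (AllPairs; []; _∷_)
import Data.List.Relation.Unary.AllPairs as AllPairs
import Data.List.Relation.Unary.AllPairs.Properties as AllPairs
open import Data.List.Relation.Unary.Unique.Propositional using (Unique)
import Data.List.Relation.Unary.Unique.Propositional.Properties as Unique
open import Data.List.Membership.Propositional using (_∈_; lose)
open import Data.List.Membership.Propositional.Properties
  using (∈-filter⁺; ∈-filter⁻; ∈-allFin; ∈-lookup; ∈-map⁺; ∈-map⁻; ∈-concatMap⁺)
open import Data.Product using (∃; _×_; _,_; proj₁; proj₂)
open import Data.Sum using (_⊎_; inj₁; inj₂)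
open import Data.Unit using (tt)
open import Data.Vec using (Vec; []; _∷_; _[_]≔_; fromList)
import Data.Vec as V
open import Data.Vec.Properties
  using (lookup∘update; lookup∘update′; lookup-allFin; tabulate∘lookup; tabulate-cong; ∷-injective)
open import Function using (_∘_; id)
open import Function.Bundles using (module Equivalence)
open import Function.Definitions using (Injective)
open import Relation.Binary.Definitions using (tri<; tri≈; tri>)
open import Relation.Binary.PropositionalEquality
  using (_≡_; _≢_; refl; sym; trans; cong; subst; _≗_; module ≡-Reasoning)
open import Relation.Nullary using (Dec; ¬_; yes; no; does; contradiction)
open import Relation.Nullary.Decidable using (dec-true; dec-false)

-- Injections between finite sets, and lists without repetition

Inj : {A B : Set} → (A → B) → Set
Inj = Injective _≡_ _≡_

-- If `y` were missed, sending one new element to `y` would extend `f` to an injection of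
-- `Fin (suc n)` into `Fin n`.
injective⇒surjective : ∀ {n} {f : Fin n → Fin n} → Inj f → ∀ y → ∃ λ x → f x ≡ y
injective⇒surjective {n} {f} inj y with F.any? (λ x → f x F.≟ y)
... | yes hit = hit
... | no miss = ⊥-elim (F.<⇒notInjective (ℕ.n<1+n n) g-inj)
  where
  g : Fin (suc n) → Fin n
  g zero    = y
  g (suc x) = f x
  g-inj : Inj g
  g-inj {zero}  {zero}  _  = refl
  g-inj {zero}  {suc b} eq = contradiction (b , sym eq) miss
  g-inj {suc a} {zero}  eq = contradiction (a , eq) miss
  g-inj {suc a} {suc b} eq = cong suc (inj eq)

section-injective : {A B : Set} {f : A → B} {s : B → A} → (∀ y → f (s y) ≡ y) → Inj s
section-injective {f = f} fs {x} {y} eq = trans (sym (fs x)) (trans (cong f eq) (fs y))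

-- `s` is injective, hence surjective, so every `x` has the form `s y`.
section⇒retraction : ∀ {n} (f s : Fin n → Fin n) → (∀ y → f (s y) ≡ y) → ∀ x → s (f x) ≡ x
section⇒retraction f s fs x with injective⇒surjective (section-injective {f = f} fs) x
... | y , refl = cong s (fs y)

lookup-AllPairs : ∀ {A : Set} {R : A → A → Set} {xs} → AllPairs R xs →
                  ∀ {i j} → i F.< j → R (lookup xs i) (lookup xs j)
lookup-AllPairs (px ∷ _)   {zero}  {suc j} _         = All.lookup px (∈-lookup j)
lookup-AllPairs (_  ∷ pxs) {suc i} {suc j} (s≤s i<j) = lookup-AllPairs pxs i<j

lookup-injective : ∀ {A : Set} {xs : List A} → Unique xs → Inj (lookup xs)
lookup-injective uniq {i} {j} eq with F.<-cmp i j
... | tri≈ _ i≡j _ = i≡j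
... | tri< i<j _ _ = contradiction eq (lookup-AllPairs uniq i<j)
... | tri> _ _ j<i = contradiction (sym eq) (lookup-AllPairs uniq j<i)

index-injective : ∀ {A : Set} {xs : List A} {x y} (x∈ : x ∈ xs) (y∈ : y ∈ xs) →
                  index x∈ ≡ index y∈ → x ≡ y
index-injective {xs = xs} x∈ y∈ eq =
  trans (Any.lookup-index x∈) (trans (cong (lookup xs) eq) (sym (Any.lookup-index y∈)))

-- The position of `y₀` together with the positions of the images `f x` embeds
-- `Fin (suc (length xs))` in `Fin (length ys)`. The two counts of secrets are compared in this way.
length-< : ∀ {A B : Set} (f : A → B) {xs ys y₀} → Unique xs →
           (∀ {x} → x ∈ xs → f x ∈ ys) →
           (∀ {x x′} → x ∈ xs → x′ ∈ xs → f x ≡ f x′ → x ≡ x′) →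
           y₀ ∈ ys → (∀ {x} → x ∈ xs → f x ≢ y₀) →
           length xs < length ys
length-< f {xs} {ys} uniq into inj y₀∈ avoid = F.injective⇒≤ g-inj
  where
  g : Fin (suc (length xs)) → Fin (length ys)
  g zero    = index y₀∈
  g (suc i) = index (into (∈-lookup i))
  g-inj : Inj g
  g-inj {zero}  {zero}  _  = refl
  g-inj {zero}  {suc b} eq =
    contradiction (sym (index-injective y₀∈ (into (∈-lookup b)) eq)) (avoid (∈-lookup b))
  g-inj {suc a} {zero}  eq =
    contradiction (index-injective (into (∈-lookup a)) y₀∈ eq) (avoid (∈-lookup a))
  g-inj {suc a} {suc b} eq = cong suc (lookup-injective uniq
    (inj (∈-lookup a) (∈-lookup b) (index-injective (into (∈-lookup a)) (into (∈-lookup b)) eq)))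

lookup-ext : ∀ {A : Set} {n} {u v : Vec A n} → V.lookup u ≗ V.lookup v → u ≡ v
lookup-ext {u = u} {v} eq =
  trans (sym (tabulate∘lookup u)) (trans (tabulate-cong eq) (tabulate∘lookup v))

concatMap-unique : ∀ {A B : Set} (f : A → List B) {xs} → Unique xs → (∀ x → Unique (f x)) →
                    (∀ {x y b} → b ∈ f x → b ∈ f y → x ≡ y) → Unique (concatMap f xs)
concatMap-unique f uniq each sep = Unique.concat⁺
  (All.map⁺ (All.universal each _))
  (AllPairs.map⁺ (AllPairs.map {R = _≢_} (λ x≢y {_} b∈ → x≢y (sep (proj₁ b∈) (proj₂ b∈))) uniq))

allVecs-unique : ∀ n m → Unique (allVecs n m)
allVecs-unique n zero    = [] ∷ []
allVecs-unique n (suc m) = concatMap-unique _ (Unique.allFin⁺ n)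
  (λ x → Unique.map⁺ (proj₂ ∘ ∷-injective) (allVecs-unique n m))
  (λ b∈x b∈y → heads (∈-map⁻ _ b∈x) (∈-map⁻ _ b∈y))
  where
  heads : ∀ {x y : Fin n} {b} → (∃ λ v → v ∈ allVecs n m × b ≡ x ∷ v) →
          (∃ λ v → v ∈ allVecs n m × b ≡ y ∷ v) → x ≡ y
  heads (_ , _ , refl) (_ , _ , eq) = proj₁ (∷-injective eq)

∈-allVecs : ∀ {n m} (v : Vec (Fin n) m) → v ∈ allVecs n m
∈-allVecs []      = here refl
∈-allVecs {n} {suc m} (x ∷ v) =
  ∈-concatMap⁺ (λ x → map (x ∷_) (allVecs n m)) (lose (∈-allFin x) (∈-map⁺ (x ∷_) (∈-allVecs v)))

-- Boolean tests for matches and permutations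

not⁺ : ∀ {b} → ¬ T b → T (not b)
not⁺ {true}  ¬t = ¬t tt
not⁺ {false} _  = tt

not⁻ : ∀ {b} → T (not b) → ¬ T b
not⁻ {true} ()
not⁻ {false} _ ()

==⁺ : ∀ {n} {i j : Fin n} → i ≡ j → T (i == j)
==⁺ {i = i} {j} eq with i F.≟ j
... | yes _ = tt
... | no ¬p = ¬p eq

==⁻ : ∀ {n} {i j : Fin n} → T (i == j) → i ≡ j
==⁻ {i = i} {j} t with i F.≟ j
... | yes p = p

all-allFin⁺ : ∀ {n} (p : Fin n → Bool) → (∀ i → T (p i)) → T (all p (allFin n))
all-allFin⁺ p h = All.all⁻ p (All.universal h (allFin _))

all-allFin⁻ : ∀ {n} (p : Fin n → Bool) → T (all p (allFin n)) → ∀ i → T (p i)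
all-allFin⁻ p t i = All.lookup (All.all⁺ p _ t) (∈-allFin i)

module _ {n : ℕ} {π γ : Vec (Fin n) n} where

  noMatch⁺ : (∀ i → V.lookup γ i ≢ V.lookup π i) → T (noMatch π γ)
  noMatch⁺ h = all-allFin⁺ _ (λ i → not⁺ (h i ∘ ==⁻))

  noMatch⁻ : T (noMatch π γ) → ∀ i → V.lookup γ i ≢ V.lookup π i
  noMatch⁻ t i = not⁻ (all-allFin⁻ _ t i) ∘ ==⁺

  allMatch⁺ : V.lookup γ ≗ V.lookup π → T (allMatch π γ)
  allMatch⁺ h = all-allFin⁺ _ (λ i → ==⁺ (h i))

  allMatch⁻ : T (allMatch π γ) → V.lookup γ ≗ V.lookup π
  allMatch⁻ t i = ==⁻ (all-allFin⁻ _ t i)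

-- The chosen preimages form a section of `V.lookup v`, which by finiteness is a two-sided inverse;
-- this settles the injectivity test too.
isPerm⁺ : ∀ {n} {v : Vec (Fin n) n} → (∀ y → ∃ λ x → V.lookup v x ≡ y) → T (isPerm v)
isPerm⁺ {n} {v} onto = Equivalence.from T-∧
  ( all-allFin⁺ _ (λ i → all-allFin⁺ _ (λ j → inj i j))
  , all-allFin⁺ _ (λ y → Any.any⁺ _ (lose (∈-allFin (proj₁ (onto y))) (==⁺ (proj₂ (onto y))))))
  where
  v-inj : Inj (V.lookup v)
  v-inj = section-injective {f = proj₁ ∘ onto}
    (section⇒retraction (V.lookup v) (proj₁ ∘ onto) (proj₂ ∘ onto))
  inj : ∀ i j → T (not (V.lookup v i == V.lookup v j) ∨ (i == j))
  inj i j with i F.≟ j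
  ... | yes refl = Equivalence.from T-∨ (inj₂ tt)
  ... | no i≢j   = Equivalence.from T-∨ (inj₁ (not⁺ (i≢j ∘ v-inj ∘ ==⁻)))

-- The cyclic shifts `rotR` and `rotL`

rotR-view : ∀ {k} (j : Fin k) →
            (suc (toℕ j) < k × toℕ (rotR j) ≡ suc (toℕ j)) ⊎ (suc (toℕ j) ≡ k × toℕ (rotR j) ≡ 0)
rotR-view {suc m} j with suc (toℕ j) <? suc m
... | yes p = inj₁ (p , F.toℕ-fromℕ< p)
... | no ¬p = inj₂ (ℕ.≤-antisym (F.toℕ<n j) (ℕ.≮⇒≥ ¬p) , refl)

rotR-injective : ∀ {k} → Inj (rotR {k})
rotR-injective {k} {i} {j} eq with rotR-view i | rotR-view j | cong toℕ eq
... | inj₁ (_ , p) | inj₁ (_ , q) | e = F.toℕ-injective (ℕ.suc-injective (trans (sym p) (trans e q)))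
... | inj₁ (_ , p) | inj₂ (_ , q) | e = contradiction (trans (sym p) (trans e q)) λ ()
... | inj₂ (_ , p) | inj₁ (_ , q) | e = contradiction (trans (sym p) (trans e q)) λ ()
... | inj₂ (p , _) | inj₂ (q , _) | e = F.toℕ-injective (ℕ.suc-injective (trans p (sym q)))

rotR-fixed : ∀ {k} {j : Fin k} → rotR j ≡ j → ∀ i → i ≡ j
rotR-fixed {k} {j} eq i with rotR-view j
... | inj₁ (_ , p) = contradiction (trans (sym p) (cong toℕ eq)) ℕ.1+n≢n
... | inj₂ (p , q) = F.toℕ-injective (trans i≡0 (sym j≡0))
  where
  j≡0 = trans (cong toℕ (sym eq)) q
  i≡0 : toℕ i ≡ 0
  i≡0 = ℕ.n<1⇒n≡0 (subst (toℕ i <_) (trans (sym p) (cong suc j≡0)) (F.toℕ<n i))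

-- Returning after two steps leaves room for at most two indices. This later rules out a third
-- element of a set.
rotR-2-cycle : ∀ {k} {j : Fin k} → rotR (rotR j) ≡ j → ∀ i → i ≡ j ⊎ i ≡ rotR j
rotR-2-cycle {k} {j} eq i with rotR-view j | rotR-view (rotR j) | cong toℕ eq
... | inj₁ (_ , p) | inj₁ (_ , q) | e =
  contradiction (trans (sym e) (trans q (cong suc p))) (ℕ.m≢1+n+m (toℕ j) {1})
... | inj₁ (_ , p) | inj₂ (r , q) | e = below-2 (toℕ i) refl
      (subst (toℕ i <_) (trans (sym r) (cong suc (trans p (cong suc j≡0)))) (F.toℕ<n i))
  where
  j≡0 = trans (sym e) q
  below-2 : ∀ a → toℕ i ≡ a → a < 2 → i ≡ j ⊎ i ≡ rotR j
  below-2 0 i≡ _ = inj₁ (F.toℕ-injective (trans i≡ (sym j≡0)))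
  below-2 1 i≡ _ = inj₂ (F.toℕ-injective (trans i≡ (sym (trans p (cong suc j≡0)))))
  below-2 (suc (suc a)) _ (s≤s (s≤s ()))
... | inj₂ (r , p) | inj₁ (_ , q) | e = below-2 (toℕ i) refl
      (subst (toℕ i <_) (trans (sym r) (cong suc j≡1)) (F.toℕ<n i))
  where
  j≡1 = trans (sym e) (trans q (cong suc p))
  below-2 : ∀ a → toℕ i ≡ a → a < 2 → i ≡ j ⊎ i ≡ rotR j
  below-2 0 i≡ _ = inj₂ (F.toℕ-injective (trans i≡ (sym p)))
  below-2 1 i≡ _ = inj₁ (F.toℕ-injective (trans i≡ (sym j≡1)))
  below-2 (suc (suc a)) _ (s≤s (s≤s ()))
... | inj₂ (_ , p) | inj₂ (r , q) | e =
  inj₁ (rotR-fixed (F.toℕ-injective (trans p (trans (sym q) e))) i)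

rotL-injective : ∀ {k} → Inj (rotL {k})
rotL-injective {suc m} {zero}  {zero}  _  = refl
rotL-injective {suc m} {zero}  {suc j} eq = contradiction eq F.fromℕ≢inject₁
rotL-injective {suc m} {suc i} {zero}  eq = contradiction (sym eq) F.fromℕ≢inject₁
rotL-injective {suc m} {suc i} {suc j} eq = cong suc (F.inject₁-injective eq)

rotL-view : ∀ {k} (i : Fin k) →
            (toℕ i ≡ suc (toℕ (rotL i))) ⊎ (toℕ i ≡ 0 × suc (toℕ (rotL i)) ≡ k)
rotL-view {suc m} zero    = inj₂ (refl , cong suc (F.toℕ-fromℕ m))
rotL-view {suc m} (suc i) = inj₁ (cong suc (sym (F.toℕ-inject₁ i)))

rotL-no-fixed-point : ∀ {k} → 2 ≤ k → (i : Fin k) → rotL i ≢ i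
rotL-no-fixed-point 2≤k i eq with rotL-view i
... | inj₁ p       = ℕ.1+n≢n (sym (trans (cong toℕ eq) p))
... | inj₂ (p , q) = ℕ.<⇒≢ 2≤k (trans (cong suc (sym (trans (cong toℕ eq) p))) q)

rotL-no-2-cycle : ∀ {k} → 3 ≤ k → (i : Fin k) → rotL (rotL i) ≢ i
rotL-no-2-cycle 3≤k i eq with rotL-view i | rotL-view (rotL i) | cong toℕ eq
... | inj₁ p | inj₁ q | e = ℕ.m≢1+n+m (toℕ i) {1} (trans p (cong suc (trans q (cong suc e))))
... | inj₁ p | inj₂ (q , r) | e =
  ℕ.<⇒≢ 3≤k (trans (cong suc (sym (trans e (trans p (cong suc q))))) r)
... | inj₂ (p , r) | inj₁ q | e = ℕ.<⇒≢ 3≤k (trans (cong suc (sym (trans q (cong suc (trans e p))))) r)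
... | inj₂ (p , r) | inj₂ (q , _) | e = ℕ.<⇒≢ (ℕ.<-trans ℕ.≤-refl 3≤k) (trans (cong suc (sym q)) r)

module _ {k n : ℕ} {f : Fin k → Fin n} (mono : ∀ {i j : Fin k} → i F.< j → f i F.< f j) where

  mono-reflects-< : ∀ {i j} → f i F.< f j → i F.< j
  mono-reflects-< {i} {j} lt with F.<-cmp i j
  ... | tri< i<j _ _ = i<j
  ... | tri≈ _ refl _ = contradiction lt (ℕ.<-irrefl refl)
  ... | tri> _ _ j<i = contradiction lt (ℕ.<-asym (mono j<i))

  -- Nothing in `Fin n` lies strictly between a point and its cyclic predecessor, so two such points
  -- in the range of the increasing `f` are also neighbours in the cyclic order of that range.
  cyclically-consecutive : ∀ {a b} → f a ≡ rotL (f b) → rotR a ≡ b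
  cyclically-consecutive {a} {b} eq with rotR-view a | rotL-view (f b)
  ... | inj₁ (_ , r) | inj₁ p = F.toℕ-injective (trans r (ℕ.≤-antisym a<b (ℕ.≮⇒≥ not-between)))
    where
    fb≡1+fa : toℕ (f b) ≡ suc (toℕ (f a))
    fb≡1+fa = trans p (cong (suc ∘ toℕ) (sym eq))
    a<b : a F.< b
    a<b = mono-reflects-< (ℕ.≤-reflexive (sym fb≡1+fa))
    not-between : ¬ (suc (toℕ a) < toℕ b)
    not-between lt = ℕ.<⇒≱ (mono (subst (_< toℕ b) (sym r) lt))
      (subst (_≤ toℕ (f (rotR a))) (sym fb≡1+fa) (mono (ℕ.≤-reflexive (sym r))))
  -- Here `f a` is the last point of `Fin n`, yet `rotR a` does not wrap and would have a larger
  -- image.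
  ... | inj₁ (_ , r) | inj₂ (_ , q) = ⊥-elim (ℕ.<-irrefl refl
        (ℕ.<-≤-trans (mono (ℕ.≤-reflexive (sym r)))
          (s≤s⁻¹ (subst (toℕ (f (rotR a)) <_) (trans (sym q) (cong (suc ∘ toℕ) (sym eq))) (F.toℕ<n _)))))
  -- Here `a` is the last index, yet `f b` exceeds `f a`, which puts `b` after it.
  ... | inj₂ (q , r) | inj₁ p = ⊥-elim (ℕ.<-irrefl refl
        (ℕ.<-≤-trans (mono-reflects-< {a} {b} (ℕ.≤-reflexive (sym (trans p (cong (suc ∘ toℕ) (sym eq))))))
          (s≤s⁻¹ (subst (toℕ b <_) (sym q) (F.toℕ<n b)))))
  -- Both wrap: `rotR a` and `f b` are first, so a strict order either way would give a number below
  -- 0.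
  ... | inj₂ (q , r) | inj₂ (p , _) with F.<-cmp (rotR a) b
  ... | tri< lt _ _ = contradiction (subst (toℕ (f (rotR a)) <_) p (mono lt)) λ ()
  ... | tri≈ _ e _  = e
  ... | tri> _ _ gt = contradiction (subst (toℕ b <_) r gt) λ ()

-- One round of the game as writes into a vector

inductiveS-cast : ∀ {n k} (c : Fin n → Fin n) (eq : k ≡ n) j →
                  cast eq (inductiveS n c k j) ≡ c (cast eq j)
inductiveS-cast {n} c refl j with n ≟ n
... | yes refl = trans (F.cast-is-id refl _) (cong c (sym (F.cast-is-id refl j)))
... | no n≢n   = contradiction refl n≢n

inductiveS-rotR : ∀ {n k} (c : Fin n → Fin n) → k ≢ n → ∀ j → inductiveS n c k j ≡ rotR j
inductiveS-rotR {n} {k} c k≢n j with k ≟ n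
... | yes eq = contradiction eq k≢n
... | no _   = refl

lookup-fromList : ∀ {A : Set} (xs : List A) j → V.lookup (fromList xs) j ≡ lookup xs j
lookup-fromList (x ∷ xs) zero    = refl
lookup-fromList (x ∷ xs) (suc j) = lookup-fromList xs j

lookup-allFin-cast : ∀ n j → lookup (allFin n) j ≡ cast (length-tabulate id) j
lookup-allFin-cast n j = trans
  (cong (lookup (allFin n))
    (sym (F.cast-involutive {m = n} (sym (length-tabulate id)) (length-tabulate id) j)))
  (lookup-tabulate id _)

module _ {A B : Set} {n : ℕ} (pos : A → Fin n) (val : A → B) (v : Vec B n) where

  writes : List A → Vec B n
  writes = foldr (λ j w → w [ pos j ]≔ val j) v

  writes-other : ∀ js {i} → (∀ j → pos j ≢ i) → V.lookup (writes js) i ≡ V.lookup v i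
  writes-other []       miss = refl
  writes-other (j ∷ js) miss =
    trans (lookup∘update′ (λ eq → miss j (sym eq)) (writes js) (val j)) (writes-other js miss)

  -- By injectivity of `pos`, any other write to the same cell comes from the same `j` and carries
  -- the same value, so overwriting is harmless.
  writes-at : Inj pos → ∀ {js j} → j ∈ js → V.lookup (writes js) (pos j) ≡ val j
  writes-at inj {j ∷ js} (here refl) = lookup∘update (pos j) (writes js) (val j)
  writes-at inj {j′ ∷ js} {j} (there j∈) with pos j F.≟ pos j′
  ... | yes eq rewrite inj eq = lookup∘update (pos j′) (writes js) (val j′)
  ... | no neq = trans (lookup∘update′ neq (writes js) (val j′)) (writes-at inj j∈)

module _ {n : ℕ} where

  -- Sealed, as unification would otherwise unfold these functions to large terms.
  opaque

    stepOn : Strategy → List (Fin n) → Vec (Fin n) n → Vec (Fin n) n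
    stepOn S L γ = writes (λ j → V.lookup (fromList L) (S (length L) j))
                          (λ j → V.lookup γ (V.lookup (fromList L) j)) γ (allFin (length L))

    stepOn-moved : ∀ S {L γ} → Unique L → Inj (S (length L)) → ∀ j →
                   V.lookup (stepOn S L γ) (lookup L (S (length L) j)) ≡ V.lookup γ (lookup L j)
    stepOn-moved S {L} {γ} uniq inj j = begin
      V.lookup (stepOn S L γ) (lookup L (S k j))
        ≡⟨ cong (V.lookup (stepOn S L γ)) (lookup-fromList L (S k j)) ⟨
      V.lookup (stepOn S L γ) (V.lookup (fromList L) (S k j))
        ≡⟨ writes-at _ _ γ pos-inj (∈-allFin j) ⟩
      V.lookup γ (V.lookup (fromList L) j)
        ≡⟨ cong (V.lookup γ) (lookup-fromList L j) ⟩
      V.lookup γ (lookup L j) ∎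
      where
      open ≡-Reasoning
      k : ℕ
      k = length L
      pos-inj : Inj (λ j → V.lookup (fromList L) (S k j))
      pos-inj eq = inj (lookup-injective uniq
        (trans (sym (lookup-fromList L _)) (trans eq (lookup-fromList L _))))

    stepOn-kept : ∀ S {L γ i} → (∀ j → lookup L j ≢ i) →
                  V.lookup (stepOn S L γ) i ≡ V.lookup γ i
    stepOn-kept S {L} {γ} miss =
      writes-other _ (λ j → V.lookup γ (V.lookup (fromList L) j)) γ (allFin (length L))
        (λ j eq → miss _ (trans (sym (lookup-fromList L _)) eq))

    select : (Fin n → Bool) → List (Fin n)
    select p = filterᵇ p (allFin n)

    select-cong : ∀ {p q : Fin n → Bool} → p ≗ q → select p ≡ select q
    select-cong {p} {q} eq = filter-≐ (T? ∘ p) (T? ∘ q)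
      ((λ {i} → subst T (eq i)) , (λ {i} → subst T (sym (eq i)))) (allFin n)

    lookup-select : ∀ (p : Fin n → Bool) j → p (lookup (select p) j) ≡ true
    lookup-select p j =
      Equivalence.to T-≡ (proj₂ (∈-filter⁻ (T? ∘ p) {xs = allFin n} (∈-lookup {xs = select p} j)))

    position : ∀ (p : Fin n → Bool) {i} → p i ≡ true → ∃ λ j → lookup (select p) j ≡ i
    position p {i} pi = index i∈ , sym (Any.lookup-index i∈)
      where
      i∈ : i ∈ select p
      i∈ = ∈-filter⁺ (T? ∘ p) (∈-allFin i) (Equivalence.from T-≡ pi)

    lookup-select-mono : ∀ p {i j} → i F.< j → lookup (select p) i F.< lookup (select p) j
    lookup-select-mono p =
      lookup-AllPairs (AllPairs.filter⁺ (T? ∘ p) (AllPairs.tabulate⁺-< {R = F._<_} id))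

    select-unique : ∀ p → Unique (select p)
    select-unique p = Unique.filter⁺ (T? ∘ p) (Unique.allFin⁺ n)

    -- One excluded element shortens the list. With a length other than `n`, an inductive strategy
    -- plays `rotR`.
    select-proper : ∀ (p : Fin n → Bool) {i} → p i ≡ false → length (select p) ≢ n
    select-proper p {i} pi = ℕ.<⇒≢ (subst (length (select p) <_) (length-tabulate id)
      (filter-notAll (T? ∘ p) (allFin n) (lose (∈-allFin i) (subst (¬_ ∘ T) (sym pi) id))))

    select-all : ∀ {p : Fin n → Bool} → (∀ i → p i ≡ true) → select p ≡ allFin n
    select-all {p} all-true = everything (allFin n)
      where
      everything : ∀ (L : List (Fin n)) → filterᵇ p L ≡ L
      everything []      = refl
      everything (x ∷ L) rewrite all-true x = cong (x ∷_) (everything L)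

    mismatch : Vec (Fin n) n → Vec (Fin n) n → Fin n → Bool
    mismatch γ π i = not (V.lookup γ i == V.lookup π i)

    mismatch-true : ∀ γ π {i} → V.lookup γ i ≢ V.lookup π i → mismatch γ π i ≡ true
    mismatch-true γ π {i} neq with V.lookup γ i F.≟ V.lookup π i
    ... | yes eq = contradiction eq neq
    ... | no _   = refl

    mismatch-false : ∀ γ π {i} → V.lookup γ i ≡ V.lookup π i → mismatch γ π i ≡ false
    mismatch-false γ π {i} eq with V.lookup γ i F.≟ V.lookup π i
    ... | yes _  = refl
    ... | no neq = contradiction eq neq

    -- The secret enters a round only through its set of mismatches, so the third guess can be
    -- computed from that set and the second guess.
    step≡stepOn : ∀ S π γ → step S π γ ≡ stepOn S (select (mismatch γ π)) γ
    step≡stepOn S π γ = refl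

-- Secrets won in three guesses and their admissible sets

module Game {n : ℕ} (c : Fin n → Fin n) (c-injective : Inj c) where

  S : Strategy
  S = inductiveS n c

  -- The second guess when the first has no match; `lookup-γ₂` and `c-γ₂` identify it as the inverse
  -- of `c`.
  γ₂ : Vec (Fin n) n
  γ₂ = stepOn S (allFin n) (V.allFin n)

  lookup-γ₂ : ∀ j → V.lookup γ₂ (c j) ≡ j
  lookup-γ₂ j = begin
    V.lookup γ₂ (c j)                                 ≡⟨ cong (V.lookup γ₂ ∘ c) lookup-allFin-j ⟨
    V.lookup γ₂ (c (lookup (allFin n) j′))            ≡⟨ cong (V.lookup γ₂) (lookup-S j′) ⟨
    V.lookup γ₂ (lookup (allFin n) (S (length (allFin n)) j′))
      ≡⟨ stepOn-moved S (Unique.allFin⁺ n) S-injective j′ ⟩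
    V.lookup (V.allFin n) (lookup (allFin n) j′)      ≡⟨ lookup-allFin _ ⟩
    lookup (allFin n) j′                              ≡⟨ lookup-allFin-j ⟩
    j ∎
    where
    open ≡-Reasoning
    -- `allFin n` has length `n` only up to this proof, so indices are transported by `cast`.
    len : length (allFin n) ≡ n
    len = length-tabulate id
    j′ : Fin (length (allFin n))
    j′ = cast (sym len) j
    lookup-allFin-j : lookup (allFin n) j′ ≡ j
    lookup-allFin-j = lookup-tabulate id j
    lookup-S : ∀ a → lookup (allFin n) (S (length (allFin n)) a) ≡ c (lookup (allFin n) a)
    lookup-S a = trans (lookup-allFin-cast n _)
      (trans (inductiveS-cast c len a) (cong c (sym (lookup-allFin-cast n a))))
    S-injective : Inj (S (length (allFin n)))
    S-injective {a} {b} eq = lookup-injective (Unique.allFin⁺ n) (c-injective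
      (trans (sym (lookup-S a)) (trans (cong (lookup (allFin n)) eq) (lookup-S b))))

  c-γ₂ : ∀ i → c (V.lookup γ₂ i) ≡ i
  c-γ₂ = section⇒retraction (V.lookup γ₂) c lookup-γ₂

  γ₂-injective : Inj (V.lookup γ₂)
  γ₂-injective = section-injective {f = c} c-γ₂

  -- The third guess when the second fails exactly on `p`, hence the only secret with these
  -- mismatches that this guess can win.
  secret : (Fin n → Bool) → Vec (Fin n) n
  secret p = stepOn S (select p) γ₂

  module _ {p : Fin n → Bool} where

    secret-kept : ∀ {i} → p i ≡ false → V.lookup (secret p) i ≡ V.lookup γ₂ i
    secret-kept pi = stepOn-kept S
      (λ j eq → contradiction (trans (sym (lookup-select p j)) (trans (cong p eq) pi)) λ ())

    secret-moved : length (select p) ≢ n → ∀ j →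
      V.lookup (secret p) (lookup (select p) (rotR j)) ≡ V.lookup γ₂ (lookup (select p) j)
    secret-moved proper j =
      subst (λ a → V.lookup (secret p) (lookup (select p) a) ≡ V.lookup γ₂ (lookup (select p) j))
        (S≗rotR j)
        (stepOn-moved S (select-unique p)
          (λ {a} {b} eq → rotR-injective (trans (sym (S≗rotR a)) (trans eq (S≗rotR b)))) j)
      where
      S≗rotR : ∀ a → S (length (select p)) a ≡ rotR a
      S≗rotR = inductiveS-rotR c proper

  -- p is the indicator of the set I, and rotR is the cyclic successor in its increasing enumeration.
  record Admissible (p : Fin n → Bool) : Set where
    field
      {x y z} : Fin n
      x≢y     : x ≢ y
      x∈      : p x ≡ true
      y∈      : p y ≡ true
      z∉      : p z ≡ false
      avoids  : ∀ j → c (lookup (select p) (rotR j)) ≢ lookup (select p) j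

    proper : length (select p) ≢ n
    proper = select-proper p z∉

  module _ {π : Vec (Fin n) n} where

    guess-1 : (∀ i → V.lookup π i ≢ i) → guess S π 1 ≡ γ₂
    guess-1 derangement = trans (step≡stepOn S π (V.allFin n))
      (cong (λ L → stepOn S L (V.allFin n)) (select-all (λ i → mismatch-true (V.allFin n) π
        (λ eq → derangement i (trans (sym eq) (lookup-allFin i))))))

    guess-2 : (∀ i → V.lookup π i ≢ i) → guess S π 2 ≡ secret (mismatch γ₂ π)
    guess-2 derangement = trans (cong (step S π) (guess-1 derangement)) (step≡stepOn S π γ₂)

    record Won : Set where
      field
        derangement : ∀ i → V.lookup π i ≢ i
        hit         : ∃ λ i → V.lookup γ₂ i ≡ V.lookup π i
        miss        : ∃ λ i → V.lookup γ₂ i ≢ V.lookup π i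
        win         : V.lookup (secret (mismatch γ₂ π)) ≗ V.lookup π

    private
      at₁ : (∀ i → V.lookup π i ≢ i) → V.lookup (guess S π 1) ≗ V.lookup γ₂
      at₁ derangement a = cong (λ v → V.lookup v a) (guess-1 derangement)

      at₂ : (∀ i → V.lookup π i ≢ i) → V.lookup (guess S π 2) ≗ V.lookup (secret (mismatch γ₂ π))
      at₂ derangement a = cong (λ v → V.lookup v a) (guess-2 derangement)

      clauses⁺ : ∀ a b c d e → T a → ¬ T b → ¬ T c → ¬ T d → T e →
                 T (a ∧ not b ∧ not c ∧ not d ∧ e)
      clauses⁺ true false false false true _ _ _ _ _ = tt
      clauses⁺ true true  _ _ _ _ ¬b _ _ _ = ¬b tt
      clauses⁺ true false true  _ _ _ _ ¬c _ _ = ¬c tt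
      clauses⁺ true false false true  _ _ _ _ ¬d _ = ¬d tt

      clauses⁻ : ∀ a b c d e → T (a ∧ not b ∧ not c ∧ not d ∧ e) →
                 T a × ¬ T c × ¬ T d × T e
      clauses⁻ true false false false true _ = tt , id , id , tt

      good-clauses⁻ : T (good S π) →
                      T (noMatch π (V.allFin n)) × ¬ T (noMatch π (guess S π 1)) ×
                      ¬ T (allMatch π (guess S π 1)) × T (allMatch π (guess S π 2))
      good-clauses⁻ = clauses⁻ (noMatch π (V.allFin n)) (allMatch π (V.allFin n))
        (noMatch π (guess S π 1)) (allMatch π (guess S π 1)) (allMatch π (guess S π 2))

    good⁺ : Won → T (good S π)
    good⁺ w = clauses⁺ (noMatch π (V.allFin n)) (allMatch π (V.allFin n))
      (noMatch π (guess S π 1)) (allMatch π (guess S π 1)) (allMatch π (guess S π 2))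
      (noMatch⁺ {π = π} {V.allFin n} off₀)
      -- The position supplied by `hit` is where a full match of the first guess contradicts the
      -- derangement.
      (λ m → off₀ (proj₁ hit) (allMatch⁻ {π = π} {V.allFin n} m _))
      (λ m → noMatch⁻ {π = π} {guess S π 1} m _ (trans (at₁ derangement _) (proj₂ hit)))
      (λ m → proj₂ miss (trans (sym (at₁ derangement _)) (allMatch⁻ {π = π} {guess S π 1} m _)))
      (allMatch⁺ {π = π} {guess S π 2} (λ i → trans (at₂ derangement i) (win i)))
      where
      open Won w
      off₀ : ∀ i → V.lookup (V.allFin n) i ≢ V.lookup π i
      off₀ i eq = derangement i (trans (sym eq) (lookup-allFin i))

    good⁻ : T (good S π) → Won
    good⁻ t = record
      { derangement = derangement
      ; hit  = some-hit
      ; miss = F.¬∀⟶∃¬ n (λ i → V.lookup γ₂ i ≡ V.lookup π i) (λ i → V.lookup γ₂ i F.≟ V.lookup π i)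
                 (λ m → not-all (allMatch⁺ {π = π} {guess S π 1} (λ i → trans (at₁ derangement i) (m i))))
      ; win  = λ i → trans (sym (at₂ derangement i)) (allMatch⁻ {π = π} {guess S π 2} all₃ i)
      }
      where
      none₁ = proj₁ (good-clauses⁻ t)
      not-none = proj₁ (proj₂ (good-clauses⁻ t))
      not-all = proj₁ (proj₂ (proj₂ (good-clauses⁻ t)))
      all₃ = proj₂ (proj₂ (proj₂ (good-clauses⁻ t)))
      derangement : ∀ i → V.lookup π i ≢ i
      derangement i eq = noMatch⁻ {π = π} {V.allFin n} none₁ i (trans (lookup-allFin i) (sym eq))
      some-hit : ∃ λ i → V.lookup γ₂ i ≡ V.lookup π i
      some-hit with F.any? (λ i → V.lookup γ₂ i F.≟ V.lookup π i)
      ... | yes h = h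
      ... | no ¬h = ⊥-elim (not-none (noMatch⁺ {π = π} {guess S π 1}
        (λ i eq → ¬h (i , trans (sym (at₁ derangement i)) eq))))

  -- A winning third guess is the secret itself, so a counted secret is determined by its set of
  -- mismatches.
  secret-mismatch : ∀ {π} → T (good S π) → secret (mismatch γ₂ π) ≡ π
  secret-mismatch {π} t = lookup-ext (Won.win (good⁻ {π} t))

  good⇒admissible : ∀ {π} → T (good S π) → Admissible (mismatch γ₂ π)
  good⇒admissible {π} t = record
    -- `x` is a mismatch and `y` its cyclic successor in the set. Were they equal, the shift would
    -- leave `x` in place and the second guess would be right there.
    { x≢y    = λ x≡y → proj₂ miss (trans (cong (V.lookup γ₂) (sym at-j))
                 (trans (sym (moved j)) (cong (V.lookup π) (sym x≡y))))
    ; x∈     = x∈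
    ; y∈     = lookup-select p (rotR j)
    ; z∉     = z∉
    -- If `c` sent an element to its predecessor, the secret there would be `γ₂` of that image,
    -- making the element a fixed point.
    ; avoids = λ j eq → derangement _ (trans (moved j) (trans (cong (V.lookup γ₂) (sym eq)) (lookup-γ₂ _)))
    }
    where
    open Won (good⁻ {π} t)
    p : Fin n → Bool
    p = mismatch γ₂ π
    x∈ : p (proj₁ miss) ≡ true
    x∈ = mismatch-true γ₂ π (proj₂ miss)
    z∉ : p (proj₁ hit) ≡ false
    z∉ = mismatch-false γ₂ π (proj₂ hit)
    moved : ∀ j → V.lookup π (lookup (select p) (rotR j)) ≡ V.lookup γ₂ (lookup (select p) j)
    moved j = trans (sym (win _)) (secret-moved (select-proper p z∉) j)
    j = proj₁ (position p x∈)
    at-j : lookup (select p) j ≡ proj₁ miss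
    at-j = proj₂ (position p x∈)

  module _ (no-fixed-point : ∀ i → c i ≢ i) {p : Fin n → Bool} (adm : Admissible p) where

    open Admissible adm

    private
      at : Fin (length (select p)) → Fin n
      at = lookup (select p)

      moved : ∀ j → V.lookup (secret p) (at (rotR j)) ≡ V.lookup γ₂ (at j)
      moved = secret-moved proper

      predecessor : ∀ {i} → p i ≡ true → ∃ λ j → at (rotR j) ≡ i
      predecessor pi with position p pi
      ... | b , at-b with injective⇒surjective rotR-injective b
      ... | j , rot-j = j , trans (cong at rot-j) at-b

      rotR-moves : ∀ j → rotR j ≢ j
      rotR-moves j fixed = x≢y (trans (sym (proj₂ px)) (trans (cong at same) (proj₂ py)))
        where
        px = position p x∈
        py = position p y∈
        same = trans (rotR-fixed fixed (proj₁ px)) (sym (rotR-fixed fixed (proj₁ py)))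

      on-or-off : ∀ i → p i ≡ true ⊎ p i ≡ false
      on-or-off i with p i
      ... | true  = inj₁ refl
      ... | false = inj₂ refl

    -- The set has two elements, so the shifted value comes from a different position, and `γ₂` is
    -- injective.
    secret-off-γ₂ : ∀ {i} → p i ≡ true → V.lookup γ₂ i ≢ V.lookup (secret p) i
    secret-off-γ₂ pi eq with predecessor pi
    ... | j , refl = rotR-moves j
      (lookup-injective (select-unique p) (γ₂-injective (trans eq (moved j))))

    mismatch-secret : mismatch γ₂ (secret p) ≗ p
    mismatch-secret i with on-or-off i
    ... | inj₁ pi = trans (mismatch-true γ₂ (secret p) (secret-off-γ₂ pi)) (sym pi)
    ... | inj₂ pi = trans (mismatch-false γ₂ (secret p) (sym (secret-kept pi))) (sym pi)

    -- Off the set a fixed point would be one of `c`; on the set it is excluded by `avoids`.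
    secret-derangement : ∀ i → V.lookup (secret p) i ≢ i
    secret-derangement i eq with on-or-off i
    ... | inj₂ pi = no-fixed-point i
      (trans (cong c (trans (sym eq) (secret-kept pi))) (c-γ₂ i))
    ... | inj₁ pi with predecessor pi
    ... | j , refl = avoids j (trans (cong c (trans (sym eq) (moved j))) (c-γ₂ (at j)))

    secret-onto : ∀ y → ∃ λ i → V.lookup (secret p) i ≡ y
    secret-onto y with on-or-off (c y)
    ... | inj₂ off = c y , trans (secret-kept off) (lookup-γ₂ y)
    ... | inj₁ on with position p on
    ... | j , at-j = at (rotR j) , trans (moved j) (trans (cong (V.lookup γ₂) at-j) (lookup-γ₂ y))

    secret-good : T (good S (secret p))
    secret-good = good⁺ {secret p} record
      { derangement = secret-derangement
      ; hit  = z , sym (secret-kept z∉)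
      ; miss = x , secret-off-γ₂ x∈
      -- The mismatches of `secret p` are `p` again, so the third guess is built from the same list.
      ; win  = λ i → cong (λ L → V.lookup (stepOn S L γ₂) i) (select-cong mismatch-secret)
      }

    secret-counted : secret p ∈ filterᵇ (good S) (Sn n)
    secret-counted = ∈-filter⁺ (T? ∘ good S)
      (∈-filter⁺ (T? ∘ isPerm) (∈-allVecs (secret p)) (isPerm⁺ {v = secret p} secret-onto))
      secret-good

  -- Independence forbids every pair `i`, `c i` in the set, `avoids` only the cyclically consecutive
  -- ones.
  independent⇒admissible : ∀ {p} {x y z : Fin n} → x ≢ y → p x ≡ true → p y ≡ true → p z ≡ false →
                           (∀ i → p i ≡ true → p (c i) ≢ true) → Admissible p
  independent⇒admissible {p} x≢y x∈ y∈ z∉ indep = record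
    { x≢y = x≢y ; x∈ = x∈ ; y∈ = y∈ ; z∉ = z∉
    ; avoids = λ j eq → indep _ (lookup-select p (rotR j)) (trans (cong p eq) (lookup-select p j)) }

-- Conjugating an arbitrary `n`-cycle to `rotL`

suc-∸ : ∀ {m n} → m < n → n ∸ m ≡ suc (n ∸ suc m)
suc-∸ {zero}  {suc n} _         = refl
suc-∸ {suc m} {suc n} (s≤s m<n) = suc-∸ m<n

-- On a finite set the law `from-to` makes `to` and `from` mutually inverse bijections; `from`
-- carries a pair `y`, `c y` to a pair `x`, `rotL x`.
record RotLConjugation {n : ℕ} (c : Fin n → Fin n) : Set where
  field
    to from   : Fin n → Fin n
    from-to   : ∀ x → from (to x) ≡ x
    conjugate : ∀ y → from (c y) ≡ rotL (from y)

  no-fixed-point : 2 ≤ n → ∀ y → c y ≢ y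
  no-fixed-point 2≤n y eq =
    rotL-no-fixed-point 2≤n (from y) (trans (sym (conjugate y)) (cong from eq))

  no-2-cycle : 3 ≤ n → ∀ y → c (c y) ≢ y
  no-2-cycle 3≤n y eq = rotL-no-2-cycle 3≤n (from y) (trans (cong rotL (sym (conjugate y)))
    (trans (sym (conjugate (c y))) (cong from eq)))

-- `g` is the orbit of one point under `c`, and `g-onto` says that `c` is a single cycle.
module Orbit {m : ℕ} (c : Fin (suc m) → Fin (suc m)) (c-injective : Inj c) (g : ℕ → Fin (suc m))
             (g-suc : ∀ (k : ℕ) → g (suc k) ≡ c (g k)) (g-onto : ∀ (y : Fin (suc m)) → ∃ λ k → g k ≡ y) where

  private
    n : ℕ
    n = suc m

    cancel : ∀ i d → g i ≡ g (i + d) → g 0 ≡ g d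
    cancel zero    d eq = eq
    cancel (suc i) d eq =
      cancel i d (c-injective (trans (sym (g-suc i)) (trans eq (g-suc (i + d)))))

    module _ {d : ℕ} (period : g 0 ≡ g d) where

      shift : ∀ m → g (m + d) ≡ g m
      shift zero    = sym period
      shift (suc m) = trans (g-suc (m + d)) (trans (cong c (shift m)) (sym (g-suc m)))

      shifts : ∀ r q → g (r + q * d) ≡ g r
      shifts r zero    = cong g (ℕ.+-identityʳ r)
      shifts r (suc q) = trans (cong g (trans (cong (r +_) (ℕ.+-comm d (q * d)))
        (sym (ℕ.+-assoc r (q * d) d)))) (trans (shift (r + q * d)) (shifts r q))

    -- Reducing an index modulo the period `suc d` does not change the value of `g`.
    residue : ∀ {d} → g 0 ≡ g (suc d) → ∀ y → ∃ λ (r : Fin (suc d)) → g (toℕ r) ≡ y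
    residue {d} period y with g-onto y
    ... | k , refl = fromℕ< (m%n<n k (suc d)) , (begin
      g (toℕ (fromℕ< (m%n<n k (suc d))))      ≡⟨ cong g (F.toℕ-fromℕ< (m%n<n k (suc d))) ⟩
      g (k % suc d)                           ≡⟨ shifts period (k % suc d) (k / suc d) ⟨
      g (k % suc d + (k / suc d) * suc d)     ≡⟨ cong g (m≡m%n+[m/n]*n k (suc d)) ⟨
      g k ∎)
      where open ≡-Reasoning

    n≤period : ∀ {d} → g 0 ≡ g (suc d) → n ≤ suc d
    n≤period period = F.injective⇒≤
      (section-injective {f = g ∘ toℕ} {s = proj₁ ∘ residue period} (proj₂ ∘ residue period))

    -- By the pigeonhole principle two of the values from `g 0` to `g n` agree. Cancelling gives a
    -- positive period of at most `n`, and `n≤period` excludes a smaller one.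
    period-n : g 0 ≡ g n
    period-n with F.pigeonhole (ℕ.n<1+n n) (g ∘ toℕ)
    ... | i , j , i<j , eq with ℕ.m≤n⇒∃[o]m+o≡n i<j
    ... | d , 1+i+d≡j = trans period (cong g (ℕ.≤-antisym 1+d≤n (n≤period period)))
      where
      i+1+d≡j = trans (ℕ.+-suc (toℕ i) d) 1+i+d≡j
      period : g 0 ≡ g (suc d)
      period = cancel (toℕ i) (suc d) (trans eq (cong g (sym i+1+d≡j)))
      1+d≤n : suc d ≤ n
      1+d≤n = ℕ.≤-trans (subst (suc d ≤_) i+1+d≡j (ℕ.m≤n+m (suc d) (toℕ i))) (s≤s⁻¹ (F.toℕ<n j))

    -- The orbit is walked backwards, starting and ending at g n = g 0, because rotL decreases indices.
    walk : Fin n → Fin n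
    walk x = g (n ∸ toℕ x)

    walk-rotL : ∀ x → walk (rotL x) ≡ c (walk x)
    walk-rotL x with rotL-view x
    ... | inj₁ p = trans (cong g (trans (suc-∸ (F.toℕ<n (rotL x))) (cong (λ k → suc (n ∸ k)) (sym p))))
                         (g-suc (n ∸ toℕ x))
    -- `x` is the first index and `rotL x` the last: the walk passes from `g n` to `g 1`, which is
    -- one step of `c` because `g n` equals `g 0`.
    ... | inj₂ (p , q) = begin
      g (n ∸ toℕ (rotL x))        ≡⟨ cong g (suc-∸ (F.toℕ<n (rotL x))) ⟩
      g (suc (n ∸ suc (toℕ (rotL x)))) ≡⟨ cong (λ k → g (suc (n ∸ k))) q ⟩
      g (suc (n ∸ n))             ≡⟨ cong (g ∘ suc) (ℕ.n∸n≡0 n) ⟩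
      g 1                         ≡⟨ g-suc 0 ⟩
      c (g 0)                     ≡⟨ cong c period-n ⟩
      c (g n)                     ≡⟨ cong (λ k → c (g (n ∸ k))) p ⟨
      c (walk x) ∎
      where open ≡-Reasoning

    walk-onto : ∀ y → ∃ λ x → walk x ≡ y
    -- `walk` uses the orbit indices from 1 to `n`. If the preimage of `y` under `c` is `g r` with
    -- `r < n`, then `suc r` is in this range and reaches `y`.
    walk-onto y = fromℕ< n-r<n , (begin
      g (n ∸ toℕ (fromℕ< n-r<n))  ≡⟨ cong (λ k → g (n ∸ k)) (F.toℕ-fromℕ< n-r<n) ⟩
      g (n ∸ (n ∸ suc r))         ≡⟨ cong g (ℕ.m∸[m∸n]≡n r<n) ⟩
      g (suc r)                   ≡⟨ g-suc r ⟩
      c (g r)                     ≡⟨ cong c (proj₂ residue-y′) ⟩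
      c (proj₁ c⁻¹y)              ≡⟨ proj₂ c⁻¹y ⟩
      y ∎)
      where
      open ≡-Reasoning
      c⁻¹y : ∃ λ x → c x ≡ y
      c⁻¹y = injective⇒surjective c-injective y
      residue-y′ : ∃ λ (r : Fin n) → g (toℕ r) ≡ proj₁ c⁻¹y
      residue-y′ = residue period-n (proj₁ c⁻¹y)
      r : ℕ
      r = toℕ (proj₁ residue-y′)
      r<n : r < n
      r<n = F.toℕ<n (proj₁ residue-y′)
      n-r<n : n ∸ suc r < n
      n-r<n = s≤s (ℕ.m∸n≤m m r)

    walk⁻¹ : Fin n → Fin n
    walk⁻¹ = proj₁ ∘ walk-onto

    walk-walk⁻¹ : ∀ y → walk (walk⁻¹ y) ≡ y
    walk-walk⁻¹ = proj₂ ∘ walk-onto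

    walk⁻¹-walk : ∀ x → walk⁻¹ (walk x) ≡ x
    walk⁻¹-walk = section⇒retraction walk walk⁻¹ walk-walk⁻¹

  conjugation : RotLConjugation c
  conjugation = record
    { to        = walk
    ; from      = walk⁻¹
    ; from-to   = walk⁻¹-walk
    ; conjugate = λ y → begin
        walk⁻¹ (c y)                  ≡⟨ cong (walk⁻¹ ∘ c) (walk-walk⁻¹ y) ⟨
        walk⁻¹ (c (walk (walk⁻¹ y)))  ≡⟨ cong walk⁻¹ (walk-rotL (walk⁻¹ y)) ⟨
        walk⁻¹ (walk (rotL (walk⁻¹ y))) ≡⟨ walk⁻¹-walk (rotL (walk⁻¹ y)) ⟩
        rotL (walk⁻¹ y) ∎
    }
    where open ≡-Reasoning

-- The iteration function inside IsCyclic is local to it, so it enters here as a parameter.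
cyclic⇒conjugation : ∀ {m} (σ : Permutation′ (suc m)) (f : ℕ → Fin (suc m) → Fin (suc m)) →
  (∀ i → f 0 i ≡ i) → (∀ k i → f (suc k) i ≡ σ ⟨$⟩ʳ f k i) →
  (∀ i j → ∃ λ k → f k i ≡ j) → RotLConjugation (σ ⟨$⟩ʳ_)
cyclic⇒conjugation σ f f-zero f-suc f-onto = Orbit.conjugation (σ ⟨$⟩ʳ_)
  (section-injective {f = σ ⟨$⟩ˡ_} (λ _ → inverseˡ σ))
  (λ k → f k zero) (λ k → f-suc k zero) (f-onto zero)

-- Admissible sets of `CSL` are independent

rotL-admissible⇒independent : ∀ {n p} → Game.Admissible {n} rotL rotL-injective p →
                              ∀ i → p i ≡ true → p (rotL i) ≢ true
rotL-admissible⇒independent {p = p} adm i i∈ l∈ with position p i∈ | position p l∈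
... | b , at-b | a , at-a = avoids a (begin
  rotL (lookup (select p) (rotR a))  ≡⟨ cong (rotL ∘ lookup (select p)) consecutive ⟩
  rotL (lookup (select p) b)         ≡⟨ cong rotL at-b ⟩
  rotL i                             ≡⟨ at-a ⟨
  lookup (select p) a ∎)
  where
  open ≡-Reasoning
  open Game.Admissible adm
  -- Elements adjacent in `Fin n` are adjacent in the set, so for `rotL` the condition on
  -- consecutive elements forbids every pair.
  consecutive : rotR a ≡ b
  consecutive = cyclically-consecutive (lookup-select-mono p) (trans at-a (cong rotL (sym at-b)))

-- An admissible set for `c` that is not independent

does-true⁻ : ∀ {P : Set} (P? : Dec P) → does P? ≡ true → P
does-true⁻ (yes p) _ = p

module Extra {n : ℕ} (4≤n : 4 ≤ n) (c : Fin n → Fin n) (c-injective : Inj c)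
             (conj : RotLConjugation c) {i : Fin n} (ci≢ : c i ≢ rotL i) where

  open RotLConjugation conj
  open Game c c-injective using (Admissible)

  private
    l s : Fin n
    l = rotL i
    s = c i

    2≤n : 2 ≤ n
    2≤n = ℕ.≤-trans (s≤s (s≤s z≤n)) 4≤n

    3≤n : 3 ≤ n
    3≤n = ℕ.<⇒≤ 4≤n

    elements : Vec (Fin n) 3
    elements = i ∷ l ∷ s ∷ []

  -- `l` is included to separate `s` from `i` in the cyclic order.
  extra : Fin n → Bool
  extra y = does (F.any? (λ a → V.lookup elements a F.≟ y))

  extra⁺ : ∀ a → extra (V.lookup elements a) ≡ true
  extra⁺ a = dec-true (F.any? (λ b → V.lookup elements b F.≟ V.lookup elements a)) (a , refl)

  extra⁻ : ∀ {y} → extra y ≡ true → y ≡ i ⊎ y ≡ l ⊎ y ≡ s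
  extra⁻ {y} t with does-true⁻ (F.any? (λ a → V.lookup elements a F.≟ y)) t
  ... | zero , eq           = inj₁ (sym eq)
  ... | suc zero , eq       = inj₂ (inj₁ (sym eq))
  ... | suc (suc zero) , eq = inj₂ (inj₂ (sym eq))

  private
    outside : ∃ λ z → extra z ≡ false
    outside with F.¬∀⟶∃¬ n (λ z → ∃ λ a → V.lookup elements a ≡ z)
                   (λ z → F.any? (λ a → V.lookup elements a F.≟ z))
                   -- Three entries cannot cover `Fin n`, as `n` is at least 4.
                   (λ hit → ℕ.<⇒≱ 4≤n (F.injective⇒≤
                     (section-injective {f = V.lookup elements} {s = proj₁ ∘ hit} (proj₂ ∘ hit))))
    ... | z , miss = z , dec-false (F.any? (λ a → V.lookup elements a F.≟ z)) miss

    at : Fin (length (select extra)) → Fin n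
    at = lookup (select extra)

    at-injective : Inj at
    at-injective = lookup-injective (select-unique extra)

    at⁻¹ : ∀ a → ∃ λ j → at j ≡ V.lookup elements a
    at⁻¹ a = position extra (extra⁺ a)

    jᵢ jₗ jₛ : Fin (length (select extra))
    jᵢ = proj₁ (at⁻¹ zero)
    jₗ = proj₁ (at⁻¹ (suc zero))
    jₛ = proj₁ (at⁻¹ (suc (suc zero)))

    at-jᵢ : at jᵢ ≡ i
    at-jᵢ = proj₂ (at⁻¹ zero)

    at-jₗ : at jₗ ≡ l
    at-jₗ = proj₂ (at⁻¹ (suc zero))

    at-jₛ : at jₛ ≡ s
    at-jₛ = proj₂ (at⁻¹ (suc (suc zero)))

    -- `l` is the cyclic predecessor of `i` in all of `Fin n`, hence also within the set.
    rotR-jₗ : rotR jₗ ≡ jᵢ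
    rotR-jₗ = cyclically-consecutive (lookup-select-mono extra) (trans at-jₗ (cong rotL (sym at-jᵢ)))

    before-i : ∀ {j} → at (rotR j) ≡ i → at j ≡ l
    before-i eq = trans
      (cong at (rotR-injective (trans (at-injective (trans eq (sym at-jᵢ))) (sym rotR-jₗ))))
      at-jₗ

    after-l : ∀ {j} → at j ≡ l → at (rotR j) ≡ i
    after-l eq = trans (cong (at ∘ rotR) (at-injective (trans eq (sym at-jₗ))))
      (trans (cong at rotR-jₗ) at-jᵢ)

    -- Since `i` follows `l`, having `l` follow `i` would close a 2-cycle of `rotR` and leave no
    -- index for `s`, which differs from both.
    before-l : ∀ {j} → at (rotR j) ≡ l → at j ≢ i
    before-l {j} eqₗ eqᵢ with rotR-2-cycle 2-cycle jₛ
      where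
      2-cycle : rotR (rotR jₗ) ≡ jₗ
      2-cycle = at-injective (trans
        (cong (at ∘ rotR) (trans rotR-jₗ (at-injective (trans at-jᵢ (sym eqᵢ)))))
        (trans eqₗ (sym at-jₗ)))
    ... | inj₁ eq = ci≢ (trans (sym at-jₛ) (trans (cong at eq) at-jₗ))
    ... | inj₂ eq = no-fixed-point 2≤n i
      (trans (sym at-jₛ) (trans (cong at (trans eq rotR-jₗ)) at-jᵢ))

    -- The cases run over the successor, then its predecessor. Besides the places of `i` and `l`,
    -- they use that `c` is injective and has neither fixed points nor 2-cycles.
    avoids : ∀ j → c (at (rotR j)) ≢ at j
    avoids j eq with extra⁻ (lookup-select extra (rotR j)) | extra⁻ (lookup-select extra j)
    ... | inj₁ r=i        | _ = ci≢ (trans (cong c (sym r=i)) (trans eq (before-i r=i)))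
    ... | inj₂ (inj₁ r=l) | inj₁ p=i        = before-l r=l p=i
    ... | inj₂ (inj₁ r=l) | inj₂ (inj₁ p=l) =
      no-fixed-point 2≤n l (trans (cong c (sym r=l)) (trans eq p=l))
    ... | inj₂ (inj₁ r=l) | inj₂ (inj₂ p=s) =
      rotL-no-fixed-point 2≤n i (c-injective (trans (cong c (sym r=l)) (trans eq p=s)))
    ... | inj₂ (inj₂ r=s) | inj₁ p=i        =
      no-2-cycle 3≤n i (trans (cong c (sym r=s)) (trans eq p=i))
    ... | inj₂ (inj₂ r=s) | inj₂ (inj₁ p=l) = no-fixed-point 2≤n i (trans (sym r=s) (after-l p=l))
    ... | inj₂ (inj₂ r=s) | inj₂ (inj₂ p=s) =
      no-fixed-point 2≤n s (trans (cong c (sym r=s)) (trans eq p=s))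

  extra-admissible : Admissible extra
  extra-admissible = record
    { x≢y    = no-fixed-point 2≤n i ∘ sym
    ; x∈     = extra⁺ zero
    ; y∈     = extra⁺ (suc (suc zero))
    ; z∉     = proj₂ outside
    ; avoids = avoids
    }

  -- This pair distinguishes `extra` from every relabelled set of `CSL`.
  extra-dependent : extra i ≡ true × extra (c i) ≡ true
  extra-dependent = extra⁺ zero , extra⁺ (suc (suc zero))

-- Comparing the two counts by an injection that misses a secret

CSL-beaten : ∀ {n} → 4 ≤ n → (c : Fin n → Fin n) → Inj c → RotLConjugation c →
             ∀ {i} → c i ≢ rotL i → N n (CSL n) < N n (inductiveS n c)
CSL-beaten {n} 4≤n c c-injective conj {i} ci≢ = length-< transfer
  (Unique.filter⁺ (T? ∘ good (CSL n)) (Unique.filter⁺ (T? ∘ isPerm) (allVecs-unique n n)))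
  (λ {π} π∈ → B.secret-counted c-moves (transferred {π} π∈))
  transfer-injective
  (B.secret-counted c-moves Ex.extra-admissible)
  avoids-extra
  where
  module A = Game {n} rotL rotL-injective
  module B = Game c c-injective
  module Ex = Extra 4≤n c c-injective conj ci≢
  open RotLConjugation conj

  c-moves : ∀ i → c i ≢ i
  c-moves = no-fixed-point (ℕ.≤-trans (s≤s (s≤s z≤n)) 4≤n)

  errors : Vec (Fin n) n → Fin n → Bool
  errors = mismatch A.γ₂

  -- The mismatches of a secret under `CSL` are relabelled by the conjugation, and the game for `c`
  -- turns the new set back into a secret.
  transfer : Vec (Fin n) n → Vec (Fin n) n
  transfer π = B.secret (errors π ∘ from)

  won : ∀ {π} → π ∈ filterᵇ (good (CSL n)) (Sn n) → T (good (CSL n) π)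
  won {π} π∈ = proj₂ (∈-filter⁻ (T? ∘ good (CSL n)) {v = π} {xs = Sn n} π∈)

  transfer-independent : ∀ {p} → A.Admissible p → ∀ y → p (from y) ≡ true → p (from (c y)) ≢ true
  transfer-independent {p} adm y py pcy = rotL-admissible⇒independent adm (from y) py
    (trans (cong p (sym (conjugate y))) pcy)

  transfer-admissible : ∀ {p} → A.Admissible p → B.Admissible (p ∘ from)
  transfer-admissible {p} adm = B.independent⇒admissible
    (x≢y ∘ section-injective {f = from} from-to)
    (trans (cong p (from-to x)) x∈) (trans (cong p (from-to y)) y∈) (trans (cong p (from-to z)) z∉)
    (transfer-independent adm)
    where open A.Admissible adm

  -- An admissible set can be read off its secret as the set of mismatches with `B.γ₂`.
  recover : ∀ {p q} → B.Admissible p → B.Admissible q → B.secret p ≡ B.secret q → p ≗ q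
  recover admₚ adm eq y = trans (sym (B.mismatch-secret c-moves admₚ y))
    (trans (cong (λ π → mismatch B.γ₂ π y) eq) (B.mismatch-secret c-moves adm y))

  transferred : ∀ {π} → π ∈ filterᵇ (good (CSL n)) (Sn n) → B.Admissible (errors π ∘ from)
  transferred {π} π∈ = transfer-admissible (A.good⇒admissible {π} (won {π} π∈))

  transfer-injective : ∀ {π π′} → π ∈ filterᵇ (good (CSL n)) (Sn n) →
                       π′ ∈ filterᵇ (good (CSL n)) (Sn n) → transfer π ≡ transfer π′ → π ≡ π′
  transfer-injective {π} {π′} π∈ π′∈ eq = begin
    π                     ≡⟨ A.secret-mismatch {π} (won {π} π∈) ⟨
    A.secret (errors π)   ≡⟨ cong (λ L → stepOn A.S L A.γ₂) (select-cong same-errors) ⟩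
    A.secret (errors π′)  ≡⟨ A.secret-mismatch {π′} (won {π′} π′∈) ⟩
    π′ ∎
    where
    open ≡-Reasoning
    same-errors : errors π ≗ errors π′
    -- Every `x` is `from (to x)`, so agreement of the relabelled sets gives agreement of the
    -- original ones.
    same-errors x = trans (cong (errors π) (sym (from-to x)))
      (trans (recover (transferred {π} π∈) (transferred {π′} π′∈) eq (to x)) (cong (errors π′) (from-to x)))

  avoids-extra : ∀ {π} → π ∈ filterᵇ (good (CSL n)) (Sn n) → transfer π ≢ B.secret Ex.extra
  -- Equality would identify an independent set with `extra`, which contains both `i` and `c i`.
  avoids-extra {π} π∈ eq = transfer-independent (A.good⇒admissible {π} (won {π} π∈)) i
    (trans (same i) (proj₁ Ex.extra-dependent)) (trans (same (c i)) (proj₂ Ex.extra-dependent))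
    where
    same : errors π ∘ from ≗ Ex.extra
    same = recover (transferred {π} π∈) Ex.extra-admissible eq

theorem4p11 : (n : ℕ) → 4 ≤ n → (σ : Permutation′ n) → IsCyclic σ →
    ¬ (∀ (i : Fin n) → σ ⟨$⟩ʳ i ≡ rotL i) →
    N n (CSL n) < N n (inductiveS n (σ ⟨$⟩ʳ_))
theorem4p11 (suc m) 4≤n σ cyclic σ≢rotL =
  CSL-beaten 4≤n (σ ⟨$⟩ʳ_) (section-injective {f = σ ⟨$⟩ˡ_} (λ _ → inverseˡ σ))
    (cyclic⇒conjugation σ _ (λ _ → refl) (λ _ _ → refl) cyclic)
    -- Finiteness and decidable equality yield an explicit index at which `σ` differs from `rotL`.
    (proj₂ (F.¬∀⟶∃¬ (suc m) (λ i → σ ⟨$⟩ʳ i ≡ rotL i) (λ i → (σ ⟨$⟩ʳ i) F.≟ rotL i) σ≢rotL))
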